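{- Let $k,t\geq 2$ be integers. Then $$\mathrm{gpn}(G_{k,t})=\frac{1}{k-1}\left(\frac{k^{t+2}-k^{3}}{k-1}+k^{3}(k-2)(t-1)\right)+kt.$$
   Context: For distinct vertices $u,v$ of a connected simple graph $G$, $\mathrm{gpn}_G(u,v)$ denotes the number of shortest $u$–$v$ paths in $G$, and for a graph $G$ on $n$ vertices $\mathrm{gpn}(G)=\sum_{\{u,v\}\subseteq V(G),\,u\neq v}\mathrm{gpn}_G(u,v)+n$ (sum over unordered pairs of distinct vertices). $D_k$ denotes the discrete (edgeless) graph on $k$ vertices. $G_{k,t}$ is the sequential join of $t$ copies of $D_k$: take $t$ disjoint copies of $D_k$, indexed $1,\ldots,t$, and for every $i\in\{1,\ldots,t-1\}$ add all edges between the $i$-th copy and the $(i+1)$-th copy (and no other edges). -}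

module Defs where

open import Data.Empty using (⊥)
open import Data.Fin.Base using (Fin; zero; suc; toℕ; remQuot)
import Data.Fin.Properties as Fin
import Data.Integer.Base as ℤ
open import Data.List.Base
  using (List; []; _∷_; length; head; last; map; filter; lookup; allFin;
         cartesianProduct; cartesianProductWith)
open import Data.List.Membership.Propositional using (_∈_)
open import Data.List.Membership.Propositional.Properties
  using (∈-allFin; ∈-lookup; ∈-cartesianProductWith⁺; ∈-cartesianProductWith⁻)
open import Data.List.Properties using (∷-injective)
open import Data.List.Relation.Unary.All as All using (All)
open import Data.List.Relation.Unary.AllPairs using ([]; _∷_)
open import Data.List.Relation.Unary.Any using (here; there)
open import Data.List.Relation.Unary.Linked using (Linked; linked?)
open import Data.List.Relation.Unary.Unique.Propositional using (Unique)
open import Data.List.Relation.Unary.Unique.Propositional.Properties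
  using (allFin⁺; cartesianProductWith⁺)
import Data.List.Relation.Unary.Unique.DecPropositional as DecUnique
import Data.Maybe.Properties as Maybe
open import Data.Maybe.Base using (just)
open import Data.Nat.Base using (ℕ; zero; suc; _+_; _*_; _≤_; s≤s)
open import Data.Nat.ListAction using (sum)
import Data.Nat.Properties as ℕ
open import Data.Product.Base using (_×_; _,_; proj₁; proj₂)
import Data.Rational.Base as ℚ
open import Data.Rational.Base using (ℚ; 1ℚ)
open import Data.Rational.Literals using (fromℤ)
import Data.Rational.Properties as ℚ
open import Algebra.Properties.Group ℚ.+-0-group using (x∙y⁻¹≈ε⇒x≈y)
open import Data.Sum.Base as Sum using (_⊎_; inj₁; inj₂)
open import Level using (0ℓ)
open import Relation.Binary.Core using (Rel)
open import Relation.Binary.Definitions using (Decidable; Symmetric)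
open import Relation.Binary.PropositionalEquality
  using (_≡_; refl; sym; cong)
open import Relation.Nullary using (Dec; yes; no; ¬_; contradiction)
open import Relation.Nullary.Decidable using (map′; _×-dec_; _⊎-dec_)

record SimpleGraph (n : ℕ) : Set₁ where
  field
    Adj       : Rel (Fin n) 0ℓ
    adj?      : Decidable Adj
    symmetric : Symmetric Adj
    loopless  : ∀ {v} → ¬ Adj v v

discrete : ∀ k → SimpleGraph k
discrete k = record
  { Adj       = λ _ _ → ⊥
  ; adj?      = λ _ _ → no λ ()
  ; symmetric = λ ()
  ; loopless  = λ ()
  }

Consecutive : ∀ {t} → Rel (Fin t) 0ℓ
Consecutive i j = toℕ j ≡ suc (toℕ i) ⊎ toℕ i ≡ suc (toℕ j)

-- A vertex of t disjoint copies of H is an element of Fin (t * k), split by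
-- remQuot into the index of its copy and its position inside that copy.

module _ (t : ℕ) {k : ℕ} (H : SimpleGraph k) where
  private module H = SimpleGraph H

  copy : Fin (t * k) → Fin t
  copy v = proj₁ (remQuot {t} k v)

  position : Fin (t * k) → Fin k
  position v = proj₂ (remQuot {t} k v)

  sequentialJoin : SimpleGraph (t * k)
  sequentialJoin = record
    { Adj = λ u v →
        (copy u ≡ copy v × H.Adj (position u) (position v))
        ⊎ Consecutive (copy u) (copy v)
    ; adj? = λ u v →
        ((copy u Fin.≟ copy v) ×-dec H.adj? (position u) (position v))
        ⊎-dec ((toℕ (copy v) ℕ.≟ suc (toℕ (copy u)))
               ⊎-dec (toℕ (copy u) ℕ.≟ suc (toℕ (copy v))))
    ; symmetric = Sum.map (λ (e , a) → sym e , H.symmetric a) Sum.swap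
    ; loopless = λ
        { (inj₁ (_ , a)) → H.loopless a
        ; (inj₂ (inj₁ e)) → ℕ.1+n≢n (sym e)
        ; (inj₂ (inj₂ e)) → ℕ.1+n≢n (sym e)
        }
    }

G : (k t : ℕ) → SimpleGraph (t * k)
G k t = sequentialJoin t (discrete k)

-- Lists of length at most m over Fin n; listsUpTo-complete and
-- listsUpTo-unique show that each occurs exactly once.

listsUpTo : (n m : ℕ) → List (List (Fin n))
listsUpTo n zero    = [] ∷ []
listsUpTo n (suc m) = [] ∷ cartesianProductWith _∷_ (allFin n) (listsUpTo n m)

listsUpTo-complete : ∀ {n} m (p : List (Fin n)) → length p ≤ m → p ∈ listsUpTo n m
listsUpTo-complete zero    []      _         = here refl
listsUpTo-complete (suc m) []      _         = here refl
listsUpTo-complete (suc m) (v ∷ p) (s≤s p≤m) =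
  there (∈-cartesianProductWith⁺ _∷_ (∈-allFin v) (listsUpTo-complete m p p≤m))

listsUpTo-unique : ∀ n m → Unique (listsUpTo n m)
listsUpTo-unique n zero    = All.[] ∷ []
listsUpTo-unique n (suc m) =
  All.tabulate []-fresh
  ∷ cartesianProductWith⁺ _∷_ ∷-injective (allFin⁺ n) (listsUpTo-unique n m)
  where
  []-fresh : ∀ {p} → p ∈ cartesianProductWith _∷_ (allFin n) (listsUpTo n m) →
             ¬ [] ≡ p
  []-fresh p∈ refl
    with _ , _ , _ , _ , () ← ∈-cartesianProductWith⁻ _∷_ (allFin n) (listsUpTo n m) p∈

lookup-injective : ∀ {A : Set} {xs : List A} → Unique xs →
                   ∀ {i j} → lookup xs i ≡ lookup xs j → i ≡ j
lookup-injective (_ ∷ _)  {zero}  {zero}  _  = refl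
lookup-injective (x∉ ∷ _) {zero}  {suc j} eq = contradiction eq (All.lookup x∉ (∈-lookup j))
lookup-injective (x∉ ∷ _) {suc i} {zero}  eq = contradiction (sym eq) (All.lookup x∉ (∈-lookup i))
lookup-injective (_ ∷ u)  {suc i} {suc j} eq = cong suc (lookup-injective u eq)

unique⇒length≤ : ∀ {n} {p : List (Fin n)} → Unique p → length p ≤ n
unique⇒length≤ u = Fin.injective⇒≤ (lookup-injective u)

module _ {n : ℕ} (Γ : SimpleGraph n) where
  open SimpleGraph Γ

  -- Paths are given by their vertex sequences.

  record IsPath (u v : Fin n) (p : List (Fin n)) : Set where
    constructor mkIsPath
    field
      starts : head p ≡ just u
      ends   : last p ≡ just v
      linked : Linked Adj p
      unique : Unique p

  -- Here length counts vertices, one more than the number of edges, which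
  -- leaves comparisons between paths unaffected.

  record IsShortestPath (u v : Fin n) (p : List (Fin n)) : Set where
    constructor mkIsShortestPath
    field
      isPath   : IsPath u v p
      shortest : ∀ q → IsPath u v q → length p ≤ length q

  isPath? : ∀ u v p → Dec (IsPath u v p)
  isPath? u v p =
    map′ (λ (s , e , l , d) → mkIsPath s e l d)
         (λ (mkIsPath s e l d) → s , e , l , d)
         (Maybe.≡-dec Fin._≟_ (head p) (just u)
          ×-dec Maybe.≡-dec Fin._≟_ (last p) (just v)
          ×-dec linked? adj? p
          ×-dec DecUnique.unique? Fin._≟_ p)

  isShortestPath? : ∀ u v p → Dec (IsShortestPath u v p)
  isShortestPath? u v p =
    map′ (λ (π , min) → mkIsShortestPath π λ q κ →
            All.lookup min (listsUpTo-complete n q (unique⇒length≤ (IsPath.unique κ))) κ)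
         (λ (mkIsShortestPath π min) → π , All.tabulate (λ {q} _ → min q))
         (isPath? u v p ×-dec All.all? noShorter? (listsUpTo n n))
    where
    noShorter? : ∀ q → Dec (IsPath u v q → length p ≤ length q)
    noShorter? q with isPath? u v q | length p ℕ.≤? length q
    ... | no ¬κ | _      = yes λ κ → contradiction κ ¬κ
    ... | yes _ | yes ≤q = yes λ _ → ≤q
    ... | yes κ | no ≰q  = no λ f → ≰q (f κ)

  -- By unique⇒length≤ every path occurs in listsUpTo n n.  The count also makes
  -- sense without connectedness: it is 0 if no path joins u to v.

  gpnBetween : Fin n → Fin n → ℕ
  gpnBetween u v = length (filter (isShortestPath? u v) (listsUpTo n n))

-- The unordered pair {u , v} is represented by (u , v) with u < v.

unorderedPairs : ∀ n → List (Fin n × Fin n)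
unorderedPairs n =
  filter (λ (u , v) → u Fin.<? v) (cartesianProduct (allFin n) (allFin n))

gpn : ∀ {n} → SimpleGraph n → ℕ
gpn {n} Γ = sum (map (λ (u , v) → gpnBetween Γ u v) (unorderedPairs n)) + n

fromℕ : ℕ → ℚ
fromℕ n = fromℤ (ℤ.+ n)

k-1-nonZero : ∀ {k} → 2 ≤ k → ℚ.NonZero (fromℕ k ℚ.- 1ℚ)
k-1-nonZero {suc (suc k)} (s≤s (s≤s _)) =
  ℚ.≢-nonZero λ k-1≡0 →
    contradiction (cong ℚ.↥_ (x∙y⁻¹≈ε⇒x≈y (fromℕ (suc (suc k))) 1ℚ k-1≡0)) λ ()

{-# OPTIONS --safe #-}

-- Write the index of its copy as the level of a vertex; levels of adjacent vertices
-- differ by exactly one.  Hence a geodesic between levels i < j rises at every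
-- step, and its j - i - 1 inner vertices are free: there are k ^ (j - i - 1).
-- Two distinct vertices of the same level are at distance two, joined through any
-- vertex of the at most two adjacent levels, whose sizes add up over all levels to
-- 2 k (t - 1).  With m = k - 1 the geometric sum
-- a = Σ_{i < j} k ^ (j - i - 1) satisfies m² a + m t + 1 = k ^ t, and so
-- m² (k m (t - 1) k + k² a) = (k ^ (t + 2) - k³) + m k³ (k - 2) (t - 1).

module Submission where

open import Defs
import Algebra.Properties.Semiring.Sum
open import Data.Bool.Base using (if_then_else_; true; false)
open import Data.Fin.Base as Fin using (Fin; zero; suc; toℕ; combine; _↑ˡ_; _↑ʳ_)
import Data.Fin.Properties as Fin
import Data.Integer.Base as ℤ
import Data.Integer.Properties as ℤ
open import Data.List.Base as List
  using (List; []; _∷_; _++_; length; last; filter; allFin; tabulate; cartesianProduct; cartesianProductWith)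
open import Data.List.Membership.Propositional using (_∈_)
open import Data.List.Membership.Propositional.Properties
  using (∈-filter⁺; ∈-filter⁻; ∈-map⁺; ∈-map⁻; ∈-allFin; ∈-++⁺ˡ; ∈-++⁺ʳ; ∈-++⁻;
         ∈-cartesianProductWith⁺; ∈-cartesianProductWith⁻)
open import Data.List.Membership.Propositional.Properties.WithK using (unique∧set⇒bag)
open import Data.List.Properties
  using (length-map; length-++; length-tabulate; map-tabulate; map-++; map-∘; ∷-injective; ∷-injectiveˡ; ∷-injectiveʳ)
open import Data.List.Relation.Binary.BagAndSetEquality using (∼bag⇒↭)
open import Data.List.Relation.Binary.Permutation.Propositional.Properties using (↭-length)
open import Data.List.Relation.Unary.All as All using (All; []; _∷_)
open import Data.List.Relation.Unary.AllPairs using ([]; _∷_)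
open import Data.List.Relation.Unary.Any using (here)
open import Data.List.Relation.Unary.Linked using (Linked; [-]; _∷_)
open import Data.List.Relation.Unary.Unique.Propositional using (Unique)
import Data.List.Relation.Unary.Unique.Propositional.Properties as Unique
open import Data.Maybe.Base using (just)
import Data.Nat.Base as ℕ
open import Data.Nat.Base using (zero; suc; _<_; z≤n; s≤s; s<s; _∸_)
open import Data.Nat.ListAction using () renaming (sum to sumˡ)
open import Data.Nat.ListAction.Properties using (sum-++)
open import Data.Nat using (ℕ; _≤_; _^_) renaming (_+_ to _+ℕ_; _*_ to _*ℕ_)
import Data.Nat.Properties as ℕ
open import Data.Nat.Tactic.RingSolver using (solve-∀)
open import Data.Product.Base using (∃₂; _×_; _,_; proj₁; uncurry)
open import Data.Rational using (ℚ; NonZero; 1ℚ; _+_; _-_; _*_; _÷_; 1/_)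
import Data.Rational.Properties as ℚ
import Data.Rational.Unnormalised.Base as ℚᵘ
import Data.Rational.Unnormalised.Properties as ℚᵘ
open import Data.Rational.Solver using (module +-*-Solver)
open import Data.Sum.Base using (_⊎_; inj₁; inj₂)
open import Function.Base using (_∘_; id)
open import Function.Bundles using (mk⇔)
open import Relation.Binary.PropositionalEquality
  using (_≡_; _≢_; refl; sym; trans; cong; cong₂; subst; module ≡-Reasoning)
open import Relation.Nullary using (does; contradiction)
open import Relation.Unary using (Decidable)

open Algebra.Properties.Semiring.Sum ℕ.+-*-semiring
  using (sum; sum-syntax; sum-cong-≗; *-distribˡ-sum; ∑-distrib-+)

private
  variable
    A : Set
    m n : ℕ

-- Sums over finite index sets and over pairs of indices

∑-const : ∀ n c → ∑[ _ < n ] c ≡ n *ℕ c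
∑-const zero    c = refl
∑-const (suc n) c = cong (c +ℕ_) (∑-const n c)

∑-+ : ∀ m (g : Fin (m +ℕ n) → ℕ) →
      sum g ≡ ∑[ i < m ] g (i ↑ˡ n) +ℕ ∑[ j < n ] g (m ↑ʳ j)
∑-+ zero    g = refl
∑-+ (suc m) g = trans (cong (g zero +ℕ_) (∑-+ m (g ∘ suc))) (sym (ℕ.+-assoc (g zero) _ _))

∑-combine : ∀ m {n} (g : Fin (m *ℕ n) → ℕ) →
            sum g ≡ ∑[ i < m ] ∑[ j < n ] g (combine i j)
∑-combine zero        g = refl
∑-combine (suc m) {n} g =
  trans (∑-+ n g) (cong (∑[ j < n ] g (j ↑ˡ _) +ℕ_) (∑-combine m (g ∘ (n ↑ʳ_))))

-- Peeling off the least index makes sums over pairs `u < v` accessible to induction;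
-- `sum-unorderedPairs` links this form to the filtered list in the definition of `gpn`.
∑< : ∀ n → (Fin n → Fin n → ℕ) → ℕ
∑< zero    f = 0
∑< (suc n) f = ∑[ v < n ] f zero (suc v) +ℕ ∑< n (λ u v → f (suc u) (suc v))

∑<-cong : ∀ n {f g : Fin n → Fin n → ℕ} →
          (∀ u v → u Fin.< v → f u v ≡ g u v) → ∑< n f ≡ ∑< n g
∑<-cong zero    f≡g = refl
∑<-cong (suc n) f≡g =
  cong₂ _+ℕ_ (sum-cong-≗ λ v → f≡g zero (suc v) ℕ.z<s)
             (∑<-cong n λ u v u<v → f≡g (suc u) (suc v) (s<s u<v))

∑<-const : ∀ n c → ∑< n (λ _ _ → c) ≡ ∑< n (λ _ _ → 1) *ℕ c
∑<-const zero    c = refl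
∑<-const (suc n) c = begin
  ∑[ _ < n ] c +ℕ ∑< n (λ _ _ → c)                   ≡⟨ cong₂ _+ℕ_ (∑-const n c) (∑<-const n c) ⟩
  n *ℕ c +ℕ p *ℕ c                                   ≡⟨ ℕ.*-distribʳ-+ c n p ⟨
  (n +ℕ p) *ℕ c                                      ≡⟨ cong (λ x → (x +ℕ p) *ℕ c) (trans (∑-const n 1) (ℕ.*-identityʳ n)) ⟨
  (∑[ _ < n ] 1 +ℕ p) *ℕ c                           ∎
  where
  open ≡-Reasoning
  p = ∑< n (λ _ _ → 1)

-- The binomial coefficient is doubled to avoid a division; in `gpn-G` the factor two is supplied by
-- the two sides on which a layer has neighbours.
∑<-1 : ∀ n → ∑< (suc n) (λ _ _ → 1) +ℕ ∑< (suc n) (λ _ _ → 1) ≡ suc n *ℕ n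
∑<-1 zero    = refl
∑<-1 (suc n) = begin
  (sum {suc n} (λ _ → 1) +ℕ p) +ℕ (sum {suc n} (λ _ → 1) +ℕ p)
    ≡⟨ cong (λ x → (x +ℕ p) +ℕ (x +ℕ p)) (trans (∑-const (suc n) 1) (ℕ.*-identityʳ (suc n))) ⟩
  (suc n +ℕ p) +ℕ (suc n +ℕ p)  ≡⟨ rearrange n p ⟩
  suc n +ℕ suc n +ℕ (p +ℕ p)    ≡⟨ cong (suc n +ℕ suc n +ℕ_) (∑<-1 n) ⟩
  suc n +ℕ suc n +ℕ suc n *ℕ n  ≡⟨ expand n ⟩
  suc (suc n) *ℕ suc n          ∎
  where
  open ≡-Reasoning
  p = ∑< (suc n) (λ _ _ → 1)
  rearrange : ∀ n p → (suc n +ℕ p) +ℕ (suc n +ℕ p) ≡ suc n +ℕ suc n +ℕ (p +ℕ p)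
  rearrange = solve-∀
  expand : ∀ n → suc n +ℕ suc n +ℕ suc n *ℕ n ≡ suc (suc n) *ℕ suc n
  expand = solve-∀

-- All indices of the first block precede those of the second, so the mixed pairs form a full
-- rectangle.
∑<-+ : ∀ m (f : Fin (m +ℕ n) → Fin (m +ℕ n) → ℕ) →
       ∑< (m +ℕ n) f ≡
         ∑< m (λ u v → f (u ↑ˡ n) (v ↑ˡ n))
         +ℕ ∑[ u < m ] ∑[ v < n ] f (u ↑ˡ n) (m ↑ʳ v)
         +ℕ ∑< n (λ u v → f (m ↑ʳ u) (m ↑ʳ v))
∑<-+         zero    f = refl
∑<-+ {n = n} (suc m) f =
  trans (cong₂ _+ℕ_ (∑-+ m (f zero ∘ suc)) (∑<-+ m (λ u v → f (suc u) (suc v))))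
        (rearrange (∑[ v < m ] f zero (suc (v ↑ˡ n))) (∑[ v < n ] f zero (suc (m ↑ʳ v)))
          (∑< m (λ u v → f (suc (u ↑ˡ n)) (suc (v ↑ˡ n))))
          (∑[ u < m ] ∑[ v < n ] f (suc (u ↑ˡ n)) (suc (m ↑ʳ v)))
          (∑< n (λ u v → f (suc (m ↑ʳ u)) (suc (m ↑ʳ v)))))
  where
  rearrange : ∀ a b c d e → (a +ℕ b) +ℕ (c +ℕ d +ℕ e) ≡ a +ℕ c +ℕ (b +ℕ d) +ℕ e
  rearrange = solve-∀

-- `combine` orders lexicographically, so a pair `u < v` lies in one block or in blocks `i < j`.
-- Splitting off the first block by `∑<-+` gives the induction on `t`.
∑<-combine : ∀ t k {f : Fin (t *ℕ k) → Fin (t *ℕ k) → ℕ}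
             (D : Fin t → ℕ) (O : Fin t → Fin t → ℕ) →
             (∀ i a b → a Fin.< b → f (combine i a) (combine i b) ≡ D i) →
             (∀ i j a b → i Fin.< j → f (combine i a) (combine j b) ≡ O i j) →
             ∑< (t *ℕ k) f ≡ ∑< k (λ _ _ → 1) *ℕ sum D +ℕ k *ℕ k *ℕ ∑< t O
∑<-combine zero    k D O diagonal off = sym (cong₂ _+ℕ_ (ℕ.*-zeroʳ (∑< k (λ _ _ → 1))) (ℕ.*-zeroʳ (k *ℕ k)))
∑<-combine (suc t) k {f} D O diagonal off = begin
  ∑< (k +ℕ t *ℕ k) f
    ≡⟨ ∑<-+ k f ⟩
  ∑< k (λ a b → f (combine {suc t} zero a) (combine {suc t} zero b))
    +ℕ ∑[ a < k ] ∑[ v < t *ℕ k ] f (a ↑ˡ (t *ℕ k)) (k ↑ʳ v)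
    +ℕ ∑< (t *ℕ k) (λ u v → f (k ↑ʳ u) (k ↑ʳ v))
    ≡⟨ cong₂ _+ℕ_
         (cong₂ _+ℕ_ (trans (∑<-cong k (diagonal zero)) (∑<-const k (D zero))) cross)
         (∑<-combine t k (D ∘ suc) (λ i j → O (suc i) (suc j))
           (λ i → diagonal (suc i)) (λ i j a b i<j → off (suc i) (suc j) a b (s<s i<j))) ⟩
  P *ℕ D zero +ℕ k *ℕ (k *ℕ ∑[ j < t ] O zero (suc j))
    +ℕ (P *ℕ sum (D ∘ suc) +ℕ k *ℕ k *ℕ ∑< t (λ i j → O (suc i) (suc j)))
    ≡⟨ rearrange P (D zero) k (∑[ j < t ] O zero (suc j)) (sum (D ∘ suc)) (∑< t (λ i j → O (suc i) (suc j))) ⟩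
  P *ℕ sum D +ℕ k *ℕ k *ℕ ∑< (suc t) O ∎
  where
  open ≡-Reasoning
  P = ∑< k (λ _ _ → 1)
  cross : ∑[ a < k ] ∑[ v < t *ℕ k ] f (a ↑ˡ (t *ℕ k)) (k ↑ʳ v) ≡
          k *ℕ (k *ℕ ∑[ j < t ] O zero (suc j))
  cross = trans (sum-cong-≗ λ a → begin
      ∑[ v < t *ℕ k ] f (a ↑ˡ (t *ℕ k)) (k ↑ʳ v)
        ≡⟨ ∑-combine t (λ v → f (a ↑ˡ (t *ℕ k)) (k ↑ʳ v)) ⟩
      ∑[ j < t ] ∑[ b < k ] f (a ↑ˡ (t *ℕ k)) (k ↑ʳ combine j b)
        -- `a ↑ˡ _` and `k ↑ʳ combine j b` are by definition `combine zero a` and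
        -- `combine (suc j) b`, so `off` applies.
        ≡⟨ sum-cong-≗ (λ j → trans (sum-cong-≗ λ b → off zero (suc j) a b ℕ.z<s) (∑-const k _)) ⟩
      ∑[ j < t ] (k *ℕ O zero (suc j))
        ≡⟨ *-distribˡ-sum k (λ j → O zero (suc j)) ⟨
      k *ℕ ∑[ j < t ] O zero (suc j) ∎)
    (∑-const k _)
  rearrange : ∀ p d k o s r →
    p *ℕ d +ℕ k *ℕ (k *ℕ o) +ℕ (p *ℕ s +ℕ k *ℕ k *ℕ r) ≡ p *ℕ (d +ℕ s) +ℕ k *ℕ k *ℕ (o +ℕ r)
  rearrange = solve-∀

-- From sums over lists to indexed sums

sum-tabulate : ∀ (g : Fin n → ℕ) → sumˡ (tabulate g) ≡ sum g
sum-tabulate {zero}  g = refl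
sum-tabulate {suc n} g = cong (g zero +ℕ_) (sum-tabulate (g ∘ suc))

sum-allFin : ∀ (g : Fin n → ℕ) → sumˡ (List.map g (allFin n)) ≡ sum g
sum-allFin g = trans (cong sumˡ (map-tabulate id g)) (sum-tabulate g)

-- With an indicator in place of the filter the index set stays a full product, over which the sum
-- can be iterated.
sum-filter : ∀ {P : A → Set} (P? : Decidable P) (g : A → ℕ) xs →
             sumˡ (List.map g (filter P? xs)) ≡
             sumˡ (List.map (λ x → if does (P? x) then g x else 0) xs)
sum-filter P? g []       = refl
sum-filter P? g (x ∷ xs) with does (P? x)
... | true  = cong (g x +ℕ_) (sum-filter P? g xs)
... | false = sum-filter P? g xs

sum-cartesianProduct : ∀ {B : Set} (g : A × B → ℕ) xs ys →
  sumˡ (List.map g (cartesianProduct xs ys)) ≡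
  sumˡ (List.map (λ x → sumˡ (List.map (λ y → g (x , y)) ys)) xs)
sum-cartesianProduct g []       ys = refl
sum-cartesianProduct g (x ∷ xs) ys =
  trans (cong sumˡ (map-++ g (List.map (x ,_) ys) (cartesianProduct xs ys)))
  (trans (sum-++ (List.map g (List.map (x ,_) ys)) _)
         (cong₂ _+ℕ_ (cong sumˡ (sym (map-∘ ys))) (sum-cartesianProduct g xs ys)))

-- Tests against `zero` evaluate and `does (suc u <? suc v)` reduces to `does (u <? v)`, so the
-- double sum unfolds along the recursion of `∑<`.
∑∑-<? : ∀ n (f : Fin n → Fin n → ℕ) →
  ∑[ u < n ] ∑[ v < n ] (if does (u Fin.<? v) then f u v else 0) ≡ ∑< n f
∑∑-<? zero    f = refl
∑∑-<? (suc n) f = cong (∑[ v < n ] f zero (suc v) +ℕ_) (∑∑-<? n (λ u v → f (suc u) (suc v)))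

sum-unorderedPairs : ∀ n (f : Fin n → Fin n → ℕ) →
  sumˡ (List.map (λ (u , v) → f u v) (unorderedPairs n)) ≡ ∑< n f
sum-unorderedPairs n f = begin
  sumˡ (List.map (uncurry f) (unorderedPairs n))
    ≡⟨ sum-filter (λ (u , v) → u Fin.<? v) (uncurry f) (cartesianProduct (allFin n) (allFin n)) ⟩
  sumˡ (List.map g (cartesianProduct (allFin n) (allFin n)))
    ≡⟨ sum-cartesianProduct g (allFin n) (allFin n) ⟩
  sumˡ (List.map (λ u → sumˡ (List.map (λ v → g (u , v)) (allFin n))) (allFin n))
    ≡⟨ sum-allFin (λ u → sumˡ (List.map (λ v → g (u , v)) (allFin n))) ⟩
  ∑[ u < n ] sumˡ (List.map (λ v → g (u , v)) (allFin n))
    ≡⟨ sum-cong-≗ (λ u → sum-allFin (λ v → g (u , v))) ⟩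
  ∑[ u < n ] ∑[ v < n ] g (u , v)
    ≡⟨ ∑∑-<? n f ⟩
  ∑< n f ∎
  where
  open ≡-Reasoning
  g : Fin n × Fin n → ℕ
  g (u , v) = if does (u Fin.<? v) then f u v else 0

-- Counting geodesics by an explicit list

-- Duplicate-free lists with the same members are permutations of each other. Nonemptiness supplies
-- a path of length `ℓ`, and comparison with it shows that a shortest path has length at most `ℓ`.
gpnBetween≡length : ∀ (Γ : SimpleGraph n) {u v} ℓ {ps} →
  Unique ps → 0 < length ps →
  (∀ {p} → p ∈ ps → IsPath Γ u v p × length p ≡ ℓ) →
  (∀ {p} → IsPath Γ u v p → ℓ ≤ length p) →
  (∀ {p} → IsPath Γ u v p → length p ≤ ℓ → p ∈ ps) →
  gpnBetween Γ u v ≡ length ps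
gpnBetween≡length {n} Γ {u} {v} ℓ {ps@(p₀ ∷ _)} ps! _ sound bound complete =
  ↭-length (∼bag⇒↭ (unique∧set⇒bag
    (Unique.filter⁺ (isShortestPath? Γ u v) (listsUpTo-unique n n)) ps!
    (mk⇔ to from)))
  where
  to : ∀ {p} → p ∈ filter (isShortestPath? Γ u v) (listsUpTo n n) → p ∈ ps
  to p∈ with _ , mkIsShortestPath π min ← ∈-filter⁻ (isShortestPath? Γ u v) {xs = listsUpTo n n} p∈
        with π₀ , eq ← sound (here refl) =
    complete π (subst (_ ≤_) eq (min p₀ π₀))
  from : ∀ {p} → p ∈ ps → p ∈ filter (isShortestPath? Γ u v) (listsUpTo n n)
  from p∈ with π , refl ← sound p∈ =
    ∈-filter⁺ (isShortestPath? Γ u v)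
      (listsUpTo-complete n _ (unique⇒length≤ (IsPath.unique π)))
      (mkIsShortestPath π λ _ → bound)

length-cartesianProductWith : ∀ {B C : Set} (f : A → B → C) xs ys →
  length (cartesianProductWith f xs ys) ≡ length xs *ℕ length ys
length-cartesianProductWith f []       ys = refl
length-cartesianProductWith f (x ∷ xs) ys =
  trans (length-++ (List.map (f x) ys))
        (cong₂ _+ℕ_ (length-map (f x) ys) (length-cartesianProductWith f xs ys))

-- Clearing denominators and embedding ℕ in ℚ

-- Reduces the closed form of the theorem, with its nested divisions by `k - 1`, to an identity free
-- of division.
÷-twice : ∀ q .{{_ : NonZero q}} {x y z} → x + q * y ≡ q * q * z → 1/ q * (x ÷ q + y) ≡ z
÷-twice q {x} {y} {z} eq = begin
  1/ q * (x * 1/ q + y)               ≡⟨ cong (λ w → 1/ q * (x * 1/ q + w)) (ℚ.*-identityˡ y) ⟨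
  1/ q * (x * 1/ q + 1ℚ * y)          ≡⟨ cong (λ w → 1/ q * (x * 1/ q + w * y)) (ℚ.*-inverseˡ q) ⟨
  1/ q * (x * 1/ q + (1/ q * q) * y)  ≡⟨ solve 4 (λ r x q y → r :* (x :* r :+ (r :* q) :* y) := r :* r :* (x :+ q :* y)) refl (1/ q) x q y ⟩
  1/ q * 1/ q * (x + q * y)           ≡⟨ cong (1/ q * 1/ q *_) eq ⟩
  1/ q * 1/ q * (q * q * z)           ≡⟨ solve 3 (λ r q z → r :* r :* (q :* q :* z) := (r :* q) :* (r :* q) :* z) refl (1/ q) q z ⟩
  (1/ q * q) * (1/ q * q) * z         ≡⟨ cong (λ w → w * w * z) (ℚ.*-inverseˡ q) ⟩
  1ℚ * 1ℚ * z                         ≡⟨ ℚ.*-identityˡ z ⟩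
  z                                   ∎
  where
  open ≡-Reasoning
  open +-*-Solver

-- Passing to unnormalised rationals avoids the gcd in the addition of ℚ: both sides become
-- fractions over 1.
fromℕ-+ : ∀ a b → fromℕ (a +ℕ b) ≡ fromℕ a + fromℕ b
fromℕ-+ a b = ℚ.toℚᵘ-injective (ℚᵘ.≃-trans (ℚᵘ.*≡* (cong (ℤ._* ℤ.1ℤ)
    (sym (cong₂ ℤ._+_ (ℤ.*-identityʳ (ℤ.+ a)) (ℤ.*-identityʳ (ℤ.+ b))))))
  (ℚᵘ.≃-sym (ℚ.toℚᵘ-homo-+ (fromℕ a) (fromℕ b))))

fromℕ-* : ∀ a b → fromℕ (a *ℕ b) ≡ fromℕ a * fromℕ b
fromℕ-* a b = ℚ.toℚᵘ-injective (ℚᵘ.≃-trans (ℚᵘ.*≡* (cong (ℤ._* ℤ.1ℤ) (ℤ.pos-* a b)))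
  (ℚᵘ.≃-sym (ℚ.toℚᵘ-homo-* (fromℕ a) (fromℕ b))))

-- The geometric sum over pairs

-- With `g` the ordinary geometric sum, `a (suc t)` unfolds to `g t +ℕ a t`, the first summand
-- collecting the pairs with `i = 0`. This yields `m*a+t≡g`, which is then substituted into
-- `m*g+1≡^`.
∑<-geometric : ∀ m t → m *ℕ m *ℕ ∑< t (λ i j → suc m ^ (toℕ j ∸ suc (toℕ i))) +ℕ m *ℕ t +ℕ 1 ≡ suc m ^ t
∑<-geometric m t = begin
  m *ℕ m *ℕ a t +ℕ m *ℕ t +ℕ 1  ≡⟨ factor m (a t) t ⟩
  m *ℕ (m *ℕ a t +ℕ t) +ℕ 1     ≡⟨ cong (λ x → m *ℕ x +ℕ 1) (m*a+t≡g t) ⟩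
  m *ℕ g t +ℕ 1                 ≡⟨ m*g+1≡^ t ⟩
  suc m ^ t                     ∎
  where
  open ≡-Reasoning
  g a : ℕ → ℕ
  g t = ∑[ j < t ] (suc m ^ toℕ j)
  a t = ∑< t (λ i j → suc m ^ (toℕ j ∸ suc (toℕ i)))
  factor : ∀ m a t → m *ℕ m *ℕ a +ℕ m *ℕ t +ℕ 1 ≡ m *ℕ (m *ℕ a +ℕ t) +ℕ 1
  factor = solve-∀
  g-suc : ∀ t → g (suc t) ≡ 1 +ℕ suc m *ℕ g t
  g-suc t = cong suc (sym (*-distribˡ-sum (suc m) (λ (j : Fin t) → suc m ^ toℕ j)))
  m*g+1≡^ : ∀ t → m *ℕ g t +ℕ 1 ≡ suc m ^ t
  m*g+1≡^ zero    = cong (_+ℕ 1) (ℕ.*-zeroʳ m)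
  m*g+1≡^ (suc t) = begin
    m *ℕ g (suc t) +ℕ 1              ≡⟨ cong (λ x → m *ℕ x +ℕ 1) (g-suc t) ⟩
    m *ℕ (1 +ℕ suc m *ℕ g t) +ℕ 1    ≡⟨ rearrange m (g t) ⟩
    suc m *ℕ (m *ℕ g t +ℕ 1)         ≡⟨ cong (suc m *ℕ_) (m*g+1≡^ t) ⟩
    suc m *ℕ suc m ^ t               ∎
    where
    rearrange : ∀ m g → m *ℕ (1 +ℕ suc m *ℕ g) +ℕ 1 ≡ suc m *ℕ (m *ℕ g +ℕ 1)
    rearrange = solve-∀
  m*a+t≡g : ∀ t → m *ℕ a t +ℕ t ≡ g t
  m*a+t≡g zero    = cong (_+ℕ 0) (ℕ.*-zeroʳ m)
  m*a+t≡g (suc t) = begin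
    m *ℕ (g t +ℕ a t) +ℕ suc t       ≡⟨ rearrange m (g t) (a t) t ⟩
    m *ℕ g t +ℕ (m *ℕ a t +ℕ t) +ℕ 1  ≡⟨ cong (λ x → m *ℕ g t +ℕ x +ℕ 1) (m*a+t≡g t) ⟩
    m *ℕ g t +ℕ g t +ℕ 1             ≡⟨ collect m (g t) ⟩
    1 +ℕ suc m *ℕ g t                ≡⟨ g-suc t ⟨
    g (suc t)                        ∎
    where
    rearrange : ∀ m g a t → m *ℕ (g +ℕ a) +ℕ suc t ≡ m *ℕ g +ℕ (m *ℕ a +ℕ t) +ℕ 1
    rearrange = solve-∀
    collect : ∀ m g → m *ℕ g +ℕ g +ℕ 1 ≡ 1 +ℕ suc m *ℕ g
    collect = solve-∀

-- Layers of the vertex set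

Vertex : ℕ → ℕ → Set
Vertex k t = Fin (t *ℕ k)

module _ {k : ℕ} where

  -- An index `m ≥ t` gives the empty list, so the topmost layer needs no special treatment when the
  -- layer above it is taken.
  layer : ∀ t → ℕ → List (Vertex k t)
  layer zero    m       = []
  layer (suc t) zero    = List.map (_↑ˡ (t *ℕ k)) (allFin k)
  layer (suc t) (suc m) = List.map (k ↑ʳ_) (layer t m)

  layer-unique : ∀ t m → Unique (layer t m)
  layer-unique zero    m       = []
  layer-unique (suc t) zero    = Unique.map⁺ (Fin.↑ˡ-injective (t *ℕ k) _ _) (Unique.allFin⁺ k)
  layer-unique (suc t) (suc m) = Unique.map⁺ (Fin.↑ʳ-injective k _ _) (layer-unique t m)

  length-layer : ∀ {t m} → m < t → length (layer t m) ≡ k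
  length-layer {suc t} {zero}  _         =
    trans (length-map (_↑ˡ (t *ℕ k)) (allFin k)) (length-tabulate id)
  length-layer {suc t} {suc m} (s≤s m<t) =
    trans (length-map (k ↑ʳ_) (layer t m)) (length-layer m<t)

  combine∈layer : ∀ {t} (i : Fin t) a → combine i a ∈ layer t (toℕ i)
  combine∈layer zero    a = ∈-map⁺ _ (∈-allFin a)
  combine∈layer (suc i) a = ∈-map⁺ (k ↑ʳ_) (combine∈layer i a)

  ∈layer⇒combine : ∀ {t m v} → v ∈ layer t m → ∃₂ λ (i : Fin t) a → v ≡ combine i a × toℕ i ≡ m
  ∈layer⇒combine {suc t} {zero}  v∈ with a , _ , eq ← ∈-map⁻ _ v∈ = zero , a , eq , refl
  ∈layer⇒combine {suc t} {suc m} v∈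
    with w , w∈ , refl ← ∈-map⁻ (k ↑ʳ_) v∈
    with i , a , refl , eq ← ∈layer⇒combine {t} w∈ = suc i , a , refl , cong suc eq

-- Levels, and geodesics between different levels

module _ {k t : ℕ} where
  open SimpleGraph (G k t) using (Adj)

  level : Vertex k t → ℕ
  level v = toℕ (copy t (discrete k) v)

  level-combine : ∀ (i : Fin t) a → level (combine i a) ≡ toℕ i
  level-combine i a = cong (toℕ ∘ proj₁) (Fin.remQuot-combine i a)

  ∈layer⁺ : ∀ {v m} → level v ≡ m → v ∈ layer t m
  ∈layer⁺ {v} refl with i , a , refl ← Fin.combine-surjective {t} {k} v =
    subst (λ m → combine i a ∈ layer t m) (sym (level-combine i a)) (combine∈layer i a)

  ∈layer⁻ : ∀ {v m} → v ∈ layer t m → level v ≡ m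
  ∈layer⁻ v∈ with i , a , refl , eq ← ∈layer⇒combine {k} {t} v∈ = trans (level-combine i a) eq

  -- An edge inside a copy would be an edge of a discrete graph, so that case is empty.
  adj⇒consecutive : ∀ {u v} → Adj u v → level v ≡ suc (level u) ⊎ level u ≡ suc (level v)
  adj⇒consecutive (inj₂ c) = c

  -- Each edge raises the level by at most one, and `length p` is the number of edges of `u ∷ p`.
  level-last≤ : ∀ {u v} p → Linked Adj (u ∷ p) → last (u ∷ p) ≡ just v → level v ≤ level u +ℕ length p
  level-last≤ {u} []      _       refl = ℕ.m≤m+n (level u) 0
  level-last≤ {u} {v} (w ∷ p) (a ∷ l) eq   = begin
    level v                     ≤⟨ level-last≤ p l eq ⟩
    level w +ℕ length p         ≤⟨ ℕ.+-monoˡ-≤ (length p) (step (adj⇒consecutive a)) ⟩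
    suc (level u) +ℕ length p   ≡⟨ ℕ.+-suc (level u) (length p) ⟨
    level u +ℕ suc (length p)   ∎
    where
    open ℕ.≤-Reasoning
    step : level w ≡ suc (level u) ⊎ level u ≡ suc (level w) → level w ≤ suc (level u)
    step (inj₁ eq) = ℕ.≤-reflexive eq
    step (inj₂ eq) = ℕ.≤-trans (ℕ.n≤1+n _) (ℕ.≤-trans (ℕ.≤-reflexive (sym eq)) (ℕ.n≤1+n _))

  -- With level v = m + 1 + e, these are the geodesics to v from any vertex of
  -- level m, with that first vertex left out.
  ascents : ℕ → ℕ → Vertex k t → List (List (Vertex k t))
  ascents zero    m v = (v ∷ []) ∷ []
  ascents (suc e) m v = cartesianProductWith _∷_ (layer t (suc m)) (ascents e (suc m) v)

  ascents-unique : ∀ e m v → Unique (ascents e m v)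
  ascents-unique zero    m v = [] ∷ []
  ascents-unique (suc e) m v =
    Unique.cartesianProductWith⁺ _∷_ ∷-injective (layer-unique t (suc m)) (ascents-unique e (suc m) v)

  -- The inner vertices have levels `m + 1` to `m + e`; the bound makes these genuine layers of size
  -- `k` rather than empty ones.
  length-ascents : ∀ e m v → m +ℕ e < t → length (ascents e m v) ≡ k ^ e
  length-ascents zero    m v _     = refl
  length-ascents (suc e) m v m+e<t =
    trans (length-cartesianProductWith _∷_ (layer t (suc m)) (ascents e (suc m) v))
          (cong₂ _*ℕ_ (length-layer (ℕ.≤-<-trans (ℕ.m≤m+n (suc m) e) m+e<t′))
                      (length-ascents e (suc m) v m+e<t′))
    where m+e<t′ = subst (_< t) (ℕ.+-suc m e) m+e<t

  -- The last component strengthens the induction: a tail lying strictly above `u` cannot contain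
  -- `u`, which gives the distinctness of the vertices.
  ascents-sound : ∀ e {u v p} → level v ≡ level u +ℕ suc e → p ∈ ascents e (level u) v →
    IsPath (G k t) u v (u ∷ p) × length p ≡ suc e × All (λ w → level u < level w) p
  ascents-sound zero {u} {v} eq (here refl) =
    mkIsPath refl refl (inj₂ (inj₁ v≡1+u) ∷ [-]) ((u≢v ∷ []) ∷ [] ∷ []) , refl , ℕ.≤-reflexive (sym v≡1+u) ∷ []
    where
    v≡1+u : level v ≡ suc (level u)
    v≡1+u = trans eq (ℕ.+-comm (level u) 1)
    u≢v : u ≢ v
    u≢v refl = ℕ.1+n≢n (sym v≡1+u)
  ascents-sound (suc e) {u} {v} eq p∈
    with w , q , w∈ , q∈ , refl ← ∈-cartesianProductWith⁻ _∷_ (layer t (suc (level u))) _ p∈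
    with w≡1+u ← ∈layer⁻ {w} w∈
    with mkIsPath _ ends linked unique , len , above ←
           ascents-sound e {w} {v}
             (trans eq (trans (ℕ.+-suc (level u) (suc e)) (cong (_+ℕ suc e) (sym w≡1+u))))
             (subst (λ m → q ∈ ascents e m v) (sym w≡1+u) q∈) =
    mkIsPath refl ends (inj₂ (inj₁ w≡1+u) ∷ linked) (All.map <⇒≢ above′ ∷ unique) , cong suc len , above′
    where
    u<w : level u < level w
    u<w = ℕ.≤-reflexive (sym w≡1+u)
    above′ : All (λ x → level u < level x) (w ∷ q)
    above′ = u<w ∷ All.map (ℕ.<-trans u<w) above
    <⇒≢ : ∀ {x} → level u < level x → u ≢ x
    <⇒≢ lt refl = ℕ.<-irrefl refl lt

  -- There is no slack: `suc e` levels must be climbed with at most `suc e` edges. After a first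
  -- step downwards the remaining edges could not reach `v`, by `level-last≤`; hence the first step
  -- rises, and the induction continues one layer higher.
  ascents-complete : ∀ e {u v} p → level v ≡ level u +ℕ suc e →
    Linked Adj (u ∷ p) → last (u ∷ p) ≡ just v → length p ≤ suc e → p ∈ ascents e (level u) v
  ascents-complete e {u} [] eq _ refl _ = contradiction eq (ℕ.m≢1+m+n (level u) ∘ λ eq → trans eq (ℕ.+-suc (level u) e))
  ascents-complete e {u} {v} (w ∷ p) eq (a ∷ l) ends (s≤s p≤e) with adj⇒consecutive a
  ... | inj₂ u≡1+w = contradiction (begin-strict
      level v                     ≤⟨ level-last≤ p l ends ⟩
      level w +ℕ length p         ≤⟨ ℕ.+-monoʳ-≤ (level w) p≤e ⟩
      level w +ℕ e                <⟨ ℕ.+-mono-<-≤ (ℕ.≤-reflexive (sym u≡1+w)) (ℕ.n≤1+n e) ⟩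
      level u +ℕ suc e            ≡⟨ eq ⟨
      level v                     ∎) (ℕ.<-irrefl refl)
    where open ℕ.≤-Reasoning
  -- For `e = 0` no edge is left after the first one, so `w` is `v`.
  ascents-complete zero    {u} {v} (w ∷ []) eq (a ∷ l) refl (s≤s p≤e) | inj₁ w≡1+u = here refl
  ascents-complete (suc e) {u} {v} (w ∷ p) eq (a ∷ l) ends (s≤s p≤e) | inj₁ w≡1+u =
    ∈-cartesianProductWith⁺ _∷_ (∈layer⁺ {w} w≡1+u)
      (subst (λ m → p ∈ ascents e m v) w≡1+u
        (ascents-complete e p
          (trans eq (trans (ℕ.+-suc (level u) (suc e)) (cong (_+ℕ suc e) (sym w≡1+u)))) l ends p≤e))

  gpnBetween-ascending : .{{_ : ℕ.NonZero k}} → ∀ e {u v} → level v ≡ level u +ℕ suc e →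
                         gpnBetween (G k t) u v ≡ k ^ e
  gpnBetween-ascending e {u} {v} eq =
    -- A path with `suc e` edges has `suc (suc e)` vertices.
    trans (gpnBetween≡length (G k t) (suc (suc e)) {ps}
            (Unique.map⁺ ∷-injectiveʳ (ascents-unique e (level u) v))
            (subst (0 <_) (sym length-ps) (ℕ.m^n>0 k e)) sound bound complete)
          length-ps
    where
    ps = List.map (u ∷_) (ascents e (level u) v)
    length-ps : length ps ≡ k ^ e
    length-ps = trans (length-map (u ∷_) (ascents e (level u) v))
      (length-ascents e (level u) v
        (ℕ.<-trans (ℕ.≤-reflexive (sym (trans eq (ℕ.+-suc (level u) e))))
                   (Fin.toℕ<n (copy t (discrete k) v))))
    sound : ∀ {p} → p ∈ ps → IsPath (G k t) u v p × length p ≡ suc (suc e)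
    sound p∈ with q , q∈ , refl ← ∈-map⁻ (u ∷_) p∈
             with π , len , _ ← ascents-sound e {u} {v} eq q∈ = π , cong suc len
    bound : ∀ {p} → IsPath (G k t) u v p → suc (suc e) ≤ length p
    bound {_ ∷ p} (mkIsPath refl ends linked _) =
      s≤s (ℕ.+-cancelˡ-≤ (level u) (suc e) (length p)
        (ℕ.≤-trans (ℕ.≤-reflexive (sym eq)) (level-last≤ p linked ends)))
    complete : ∀ {p} → IsPath (G k t) u v p → length p ≤ suc (suc e) → p ∈ ps
    complete {_ ∷ p} (mkIsPath refl ends linked _) (s≤s len) =
      ∈-map⁺ (u ∷_) (ascents-complete e p eq linked ends len)

  -- Geodesics within one level

  -- A truncated predecessor would make level 0 adjacent to itself; hence the separate empty case.
  layerBelow : ℕ → List (Vertex k t)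
  layerBelow zero    = []
  layerBelow (suc m) = layer t m

  adjacentLayers : ℕ → List (Vertex k t)
  adjacentLayers m = layer t (suc m) ++ layerBelow m

  ∈layerBelow⁺ : ∀ {v m} → m ≡ suc (level v) → v ∈ layerBelow m
  ∈layerBelow⁺ {v} refl = ∈layer⁺ {v} refl

  ∈layerBelow⁻ : ∀ {v m} → v ∈ layerBelow m → m ≡ suc (level v)
  ∈layerBelow⁻ {v} {suc m} v∈ = cong suc (sym (∈layer⁻ {v} v∈))

  -- The two layers are disjoint because their levels differ by two: a common vertex would force
  -- `m = m + 2`.
  adjacentLayers-unique : ∀ m → Unique (adjacentLayers m)
  adjacentLayers-unique m = Unique.++⁺ (layer-unique t (suc m)) (below-unique m)
    λ {v} (v∈ , v∈′) → ℕ.m≢1+n+m m {1} (trans (∈layerBelow⁻ {v} v∈′) (cong suc (∈layer⁻ {v} v∈)))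
    where
    below-unique : ∀ m → Unique (layerBelow m)
    below-unique zero    = []
    below-unique (suc m) = layer-unique t m

  ∈adjacentLayers⁺ : ∀ {v w} → Adj v w → w ∈ adjacentLayers (level v)
  ∈adjacentLayers⁺ {v} {w} a with adj⇒consecutive a
  ... | inj₁ eq = ∈-++⁺ˡ (∈layer⁺ {w} eq)
  ... | inj₂ eq = ∈-++⁺ʳ (layer t (suc (level v))) (∈layerBelow⁺ {w} eq)

  ∈adjacentLayers⁻ : ∀ {v w} → w ∈ adjacentLayers (level v) → Adj v w
  ∈adjacentLayers⁻ {v} {w} w∈ with ∈-++⁻ (layer t (suc (level v))) w∈
  ... | inj₁ w∈ = inj₂ (inj₁ (∈layer⁻ {w} w∈))
  ... | inj₂ w∈ = inj₂ (inj₂ (∈layerBelow⁻ {w} w∈))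

  -- Level 0 has layer 1 above it because `2 ≤ t`; every other level has a layer below it.
  adjacentLayers-nonempty : .{{_ : ℕ.NonZero k}} → ∀ {m} → 2 ≤ t → m < t → 0 < length (adjacentLayers m)
  adjacentLayers-nonempty {zero} 2≤t _ =
    subst (0 <_) (sym (trans (length-++ (layer t 1)) (cong (_+ℕ 0) (length-layer 2≤t))))
      (ℕ.<-≤-trans (ℕ.>-nonZero⁻¹ k) (ℕ.m≤m+n k 0))
  adjacentLayers-nonempty {suc m} _ m<t =
    subst (0 <_) (sym (trans (length-++ (layer t (suc (suc m))))
        (cong (length (layer t (suc (suc m))) +ℕ_) (length-layer (ℕ.<-trans (ℕ.n<1+n m) m<t)))))
      (ℕ.<-≤-trans (ℕ.>-nonZero⁻¹ k) (ℕ.m≤n+m k _))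

  -- Neighbourhoods depend only on the level, so every neighbour of `u` is one of `v` and yields a
  -- path with three vertices. Nothing shorter exists, since an edge would change the level.
  gpnBetween-level : .{{_ : ℕ.NonZero k}} → ∀ {u v} → 2 ≤ t → u ≢ v → level u ≡ level v →
                     gpnBetween (G k t) u v ≡ length (adjacentLayers (level u))
  gpnBetween-level {u} {v} 2≤t u≢v u≡v =
    trans (gpnBetween≡length (G k t) 3 {ps}
            (Unique.map⁺ (∷-injectiveˡ ∘ ∷-injectiveʳ) (adjacentLayers-unique (level u)))
            (subst (0 <_) (sym length-ps)
              (adjacentLayers-nonempty 2≤t (Fin.toℕ<n (copy t (discrete k) u))))
            sound bound complete)
          length-ps
    where
    open SimpleGraph (G k t) using (symmetric; loopless)
    via : Vertex k t → List (Vertex k t)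
    via w = u ∷ w ∷ v ∷ []
    ps = List.map via (adjacentLayers (level u))
    length-ps : length ps ≡ length (adjacentLayers (level u))
    length-ps = length-map via (adjacentLayers (level u))
    adj⇒≢ : ∀ {x y} → Adj x y → x ≢ y
    adj⇒≢ a refl = loopless a
    sound : ∀ {p} → p ∈ ps → IsPath (G k t) u v p × length p ≡ 3
    sound p∈ with w , w∈ , refl ← ∈-map⁻ via p∈ =
      mkIsPath refl refl (u~w ∷ w~v ∷ [-])
        ((adj⇒≢ u~w ∷ u≢v ∷ []) ∷ (adj⇒≢ w~v ∷ []) ∷ [] ∷ []) , refl
      where
      u~w : Adj u w
      u~w = ∈adjacentLayers⁻ {u} w∈
      w~v : Adj w v
      w~v = symmetric {v} {w} (∈adjacentLayers⁻ {v} (subst (λ m → w ∈ adjacentLayers m) u≡v w∈))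
    -- The absurdity is stated as the false inequality that `bound` demands of a path with two
    -- vertices.
    u≁v : Adj u v → 3 ≤ 2
    u≁v a with adj⇒consecutive {u} {v} a
    ... | inj₁ eq = contradiction (trans (sym eq) (sym u≡v)) ℕ.1+n≢n
    ... | inj₂ eq = contradiction (trans (sym eq) u≡v) ℕ.1+n≢n
    bound : ∀ {p} → IsPath (G k t) u v p → 3 ≤ length p
    bound {_ ∷ []}        (mkIsPath refl refl _ _)         = contradiction refl u≢v
    bound {_ ∷ _ ∷ []}    (mkIsPath refl refl (a ∷ _) _)   = u≁v a
    bound {_ ∷ _ ∷ _ ∷ _} _                                = s≤s (s≤s (s≤s z≤n))
    complete : ∀ {p} → IsPath (G k t) u v p → length p ≤ 3 → p ∈ ps
    complete {p@(_ ∷ [])}     π _ = contradiction (bound π) λ { (s≤s ()) }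
    complete {p@(_ ∷ _ ∷ [])} π _ = contradiction (bound π) λ { (s≤s (s≤s ())) }
    complete {_ ∷ w ∷ _ ∷ []} (mkIsPath refl refl (a ∷ _) _) _ =
      ∈-map⁺ via (∈adjacentLayers⁺ {u} {w} a)
    complete {_ ∷ _ ∷ _ ∷ _ ∷ _} _ (s≤s (s≤s (s≤s ())))

-- Summation over all pairs and the closed form

-- Each of the `s` pairs of consecutive layers is counted once from below and once from above,
-- contributing `k` each time.
∑-adjacentLayers : ∀ k s →
  ∑[ i < suc s ] length (adjacentLayers {k} {suc s} (toℕ i)) ≡ s *ℕ k +ℕ s *ℕ k
∑-adjacentLayers k s = begin
  ∑[ i < suc s ] length (adjacentLayers {k} {suc s} (toℕ i))
    ≡⟨ sum-cong-≗ (λ i → length-++ (above i) {below i}) ⟩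
  ∑[ i < suc s ] (length (above i) +ℕ length (below i))
    ≡⟨ ∑-distrib-+ (length ∘ above) (length ∘ below) ⟩
  ∑[ i < suc s ] length (above i) +ℕ ∑[ i < suc s ] length (below i)
    ≡⟨ cong₂ _+ℕ_ (trans (sum-cong-≗ {suc s} λ i → length-map (k ↑ʳ_) (layer {k} s (toℕ i))) (∑-layer s))
                  -- Nothing lies below level 0, so the first term reduces to 0 and a sum over
                  -- `Fin s` remains.
                  (trans (sum-cong-≗ {s} λ i → length-layer {k} {suc s} (ℕ.m<n⇒m<1+n (Fin.toℕ<n i))) (∑-const s k)) ⟩
  s *ℕ k +ℕ s *ℕ k ∎
  where
  open ≡-Reasoning
  above below : Fin (suc s) → List (Vertex k (suc s))
  above i = layer (suc s) (suc (toℕ i))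
  below i = layerBelow {k} {suc s} (toℕ i)
  -- The range goes one index too far: at `i = s` the layer is empty.
  ∑-layer : ∀ s → ∑[ i < suc s ] length (layer {k} s (toℕ i)) ≡ s *ℕ k
  ∑-layer zero    = refl
  ∑-layer (suc s) = cong₂ _+ℕ_ (length-layer {k} {suc s} ℕ.z<s)
    (trans (sum-cong-≗ {suc s} λ i → length-map (k ↑ʳ_) (layer {k} s (toℕ i))) (∑-layer s))

-- The summands stem from pairs inside one copy, from pairs in different copies, and from the number
-- of vertices added in `gpn`.
gpn-G : ∀ m s → 1 ≤ s → let k = suc m; t = suc s in
  gpn (G k t) ≡
    k *ℕ m *ℕ (s *ℕ k) +ℕ k *ℕ k *ℕ ∑< t (λ i j → k ^ (toℕ j ∸ suc (toℕ i))) +ℕ t *ℕ k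
gpn-G m s 1≤s = cong (_+ℕ t *ℕ k) (begin
  sumˡ (List.map (λ (u , v) → gpnBetween (G k t) u v) (unorderedPairs (t *ℕ k)))
    ≡⟨ sum-unorderedPairs (t *ℕ k) (gpnBetween (G k t)) ⟩
  ∑< (t *ℕ k) (gpnBetween (G k t))
    ≡⟨ ∑<-combine t k {gpnBetween (G k t)} (λ i → length (adjacentLayers {k} {t} (toℕ i))) weight diagonal off ⟩
  ∑< k (λ _ _ → 1) *ℕ ∑[ i < t ] length (adjacentLayers {k} {t} (toℕ i)) +ℕ k *ℕ k *ℕ ∑< t weight
    ≡⟨ cong (_+ℕ k *ℕ k *ℕ ∑< t weight) (begin
        p *ℕ ∑[ i < t ] length (adjacentLayers {k} {t} (toℕ i)) ≡⟨ cong (p *ℕ_) (∑-adjacentLayers k s) ⟩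
        p *ℕ (s *ℕ k +ℕ s *ℕ k)  ≡⟨ double p (s *ℕ k) ⟩
        (p +ℕ p) *ℕ (s *ℕ k)     ≡⟨ cong (_*ℕ (s *ℕ k)) (∑<-1 m) ⟩
        k *ℕ m *ℕ (s *ℕ k)       ∎) ⟩
  k *ℕ m *ℕ (s *ℕ k) +ℕ k *ℕ k *ℕ ∑< t weight ∎)
  where
  open ≡-Reasoning
  k = suc m
  t = suc s
  p = ∑< k (λ _ _ → 1)
  double : ∀ p x → p *ℕ (x +ℕ x) ≡ (p +ℕ p) *ℕ x
  double = solve-∀
  weight : Fin t → Fin t → ℕ
  weight i j = k ^ (toℕ j ∸ suc (toℕ i))
  diagonal : ∀ i a b → a Fin.< b →
    gpnBetween (G k t) (combine i a) (combine i b) ≡ length (adjacentLayers {k} {t} (toℕ i))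
  diagonal i a b a<b =
    trans (gpnBetween-level {k} {t} {combine i a} {combine i b} (s≤s 1≤s)
            (λ eq → Fin.<⇒≢ a<b (Fin.combine-injectiveʳ i a i b eq))
            (trans (level-combine i a) (sym (level-combine i b))))
          (cong (length ∘ adjacentLayers {k} {t}) (level-combine i a))
  off : ∀ i j a b → i Fin.< j → gpnBetween (G k t) (combine i a) (combine j b) ≡ weight i j
  off i j a b i<j = gpnBetween-ascending {k} {t} (toℕ j ∸ suc (toℕ i)) {combine i a} {combine j b} (begin
    level {k} {t} (combine j b)                          ≡⟨ level-combine j b ⟩
    -- As `i < j`, the truncated subtraction is exact.
    toℕ j                                                ≡⟨ ℕ.m+[n∸m]≡n i<j ⟨
    suc (toℕ i) +ℕ (toℕ j ∸ suc (toℕ i))                 ≡⟨ ℕ.+-suc (toℕ i) _ ⟨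
    toℕ i +ℕ suc (toℕ j ∸ suc (toℕ i))                   ≡⟨ cong (_+ℕ suc (toℕ j ∸ suc (toℕ i))) (level-combine i a) ⟨
    level {k} {t} (combine i a) +ℕ suc (toℕ j ∸ suc (toℕ i)) ∎)

proposition3 : ∀ (k t : ℕ) (2≤k : 2 ≤ k) → 2 ≤ t →
    let instance nonZero = k-1-nonZero 2≤k in
    fromℕ (gpn (G k t)) ≡
    (1/ (fromℕ k - 1ℚ))
    * ((fromℕ (k ^ (t +ℕ 2)) - fromℕ (k ^ 3)) ÷ (fromℕ k - 1ℚ)
    + fromℕ (k ^ 3) * (fromℕ k - fromℕ 2) * (fromℕ t - 1ℚ))
    + fromℕ k * fromℕ t
proposition3 1 t (s≤s ()) _
proposition3 k@(suc m@(suc _)) t@(suc s) 2≤k (s≤s 1≤s) = begin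
  fromℕ (gpn (G k t))
    ≡⟨ cong fromℕ (gpn-G m s 1≤s) ⟩
  fromℕ (N +ℕ t *ℕ k)
    ≡⟨ fromℕ-+ N (t *ℕ k) ⟩
  fromℕ N + fromℕ (t *ℕ k)
    ≡⟨ cong₂ _+_ (sym (÷-twice (fromℕ k - 1ℚ) {{k-1-nonZero 2≤k}} {X} {Y} key))
                 (trans (cong fromℕ (ℕ.*-comm t k)) (fromℕ-* k t)) ⟩
  _ ∎
  where
  open ≡-Reasoning
  open +-*-Solver
  a = ∑< t (λ i j → k ^ (toℕ j ∸ suc (toℕ i)))
  N = k *ℕ m *ℕ (s *ℕ k) +ℕ k *ℕ k *ℕ a
  M S W K T X Y : ℚ
  M = fromℕ m
  S = fromℕ s
  W = fromℕ a
  -- Writing `k` and `t` through `M` and `S` leaves `M`, `S` and `W` as the only variables of the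
  -- final identity.
  K = 1ℚ + M
  T = 1ℚ + S
  cast-k : fromℕ k ≡ K
  cast-k = fromℕ-+ 1 m
  cast-t : fromℕ t ≡ T
  cast-t = fromℕ-+ 1 s
  cast-k* : ∀ n {x} → fromℕ n ≡ x → fromℕ (k *ℕ n) ≡ K * x
  cast-k* n eq = trans (fromℕ-* k n) (cong₂ _*_ cast-k eq)
  cast-k³ : fromℕ (k ^ 3) ≡ K * (K * (K * 1ℚ))
  cast-k³ = cast-k* (k ^ 2) (cast-k* (k ^ 1) (cast-k* 1 refl))
  -- The geometric sum eliminates the power with variable exponent, so that `key` becomes a
  -- polynomial identity within reach of the ring solver.
  cast-kᵗ : fromℕ (k ^ t) ≡ M * M * W + M * T + 1ℚ
  cast-kᵗ = begin
    fromℕ (k ^ t)                          ≡⟨ cong fromℕ (∑<-geometric m t) ⟨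
    fromℕ (m *ℕ m *ℕ a +ℕ m *ℕ t +ℕ 1)     ≡⟨ fromℕ-+ (m *ℕ m *ℕ a +ℕ m *ℕ t) 1 ⟩
    fromℕ (m *ℕ m *ℕ a +ℕ m *ℕ t) + 1ℚ     ≡⟨ cong (_+ 1ℚ) (fromℕ-+ (m *ℕ m *ℕ a) (m *ℕ t)) ⟩
    fromℕ (m *ℕ m *ℕ a) + fromℕ (m *ℕ t) + 1ℚ
      ≡⟨ cong (_+ 1ℚ) (cong₂ _+_ (trans (fromℕ-* (m *ℕ m) a) (cong (_* W) (fromℕ-* m m)))
                                 (trans (fromℕ-* m t) (cong (M *_) cast-t))) ⟩
    M * M * W + M * T + 1ℚ                 ∎
  cast-kᵗ⁺² : fromℕ (k ^ (t +ℕ 2)) ≡ K * (K * (M * M * W + M * T + 1ℚ))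
  cast-kᵗ⁺² = trans (cong (λ e → fromℕ (k ^ e)) (ℕ.+-comm t 2))
    (cast-k* (k ^ suc t) (cast-k* (k ^ t) cast-kᵗ))
  cast-N : fromℕ N ≡ K * M * (S * K) + K * K * W
  cast-N = begin
    fromℕ N  ≡⟨ fromℕ-+ (k *ℕ m *ℕ (s *ℕ k)) (k *ℕ k *ℕ a) ⟩
    fromℕ (k *ℕ m *ℕ (s *ℕ k)) + fromℕ (k *ℕ k *ℕ a)
      ≡⟨ cong₂ _+_ (trans (fromℕ-* (k *ℕ m) (s *ℕ k)) (cong₂ _*_ (cast-k* m refl) (trans (fromℕ-* s k) (cong (S *_) cast-k))))
                   (trans (fromℕ-* (k *ℕ k) a) (cong (_* W) (cast-k* k cast-k))) ⟩
    K * M * (S * K) + K * K * W ∎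
  X = fromℕ (k ^ (t +ℕ 2)) - fromℕ (k ^ 3)
  Y = fromℕ (k ^ 3) * (fromℕ k - fromℕ 2) * (fromℕ t - 1ℚ)
  key : X + (fromℕ k - 1ℚ) * Y ≡ (fromℕ k - 1ℚ) * (fromℕ k - 1ℚ) * fromℕ N
  key = begin
    X + (fromℕ k - 1ℚ) * Y
      ≡⟨ cong₂ _+_ (cong₂ _-_ cast-kᵗ⁺² cast-k³)
           (cong₂ _*_ (cong (_- 1ℚ) cast-k)
             (cong₂ _*_ (cong₂ _*_ cast-k³ (cong (_- fromℕ 2) cast-k)) (cong (_- 1ℚ) cast-t))) ⟩
    (K * (K * (M * M * W + M * T + 1ℚ)) - K * (K * (K * 1ℚ)))
      + (K - 1ℚ) * (K * (K * (K * 1ℚ)) * (K - fromℕ 2) * (T - 1ℚ))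
      ≡⟨ solve 3 (λ M S W → let one = con 1ℚ; K = one :+ M; T = one :+ S in
           (K :* (K :* (M :* M :* W :+ M :* T :+ one)) :- K :* (K :* (K :* one)))
             :+ (K :- one) :* (K :* (K :* (K :* one)) :* (K :- con (fromℕ 2)) :* (T :- one))
           := (K :- one) :* (K :- one) :* (K :* M :* (S :* K) :+ K :* K :* W)) refl M S W ⟩
    (K - 1ℚ) * (K - 1ℚ) * (K * M * (S * K) + K * K * W)
      ≡⟨ cong₂ _*_ (cong₂ _*_ (cong (_- 1ℚ) cast-k) (cong (_- 1ℚ) cast-k)) cast-N ⟨
    (fromℕ k - 1ℚ) * (fromℕ k - 1ℚ) * fromℕ N ∎
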